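{- Let $f=\bigvee_{i=1}^mT_i$ be a DNF formula of width $w$ with $m$ terms, each of which is non-constant. Then there exists $S\subseteq\{1,\dots,m\}$ with $|S|\ge m/2^w$ such that the formula $g=\bigvee_{j\in S}T_j$ is unate.
   Context: A term is an AND of literals; a DNF formula is an OR of terms; it has width $w$ if every term has at most $w$ literals. A term is non-constant if it contains at least one literal and does not contain both a variable and its negation. A DNF formula is unate if it does not contain both a variable and its negation (anywhere in the formula). -}

module Defs where

open import Data.Bool.Base using (true; false)
open import Data.Fin.Base using (Fin)
import Data.Fin.Properties as Fin
open import Data.Fin.Subset using (Subset; ∣_∣)
open import Data.List.Base using (List; length; deduplicate)
open import Data.List.Membership.Propositional using (_∈_)
open import Data.Nat.Base using (ℕ; _≤_)
open import Data.Product.Base using (_×_; ∃-syntax)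
open import Data.Vec.Base using (Vec; []; _∷_)
open import Data.Vec.Relation.Unary.All using (All)
open import Data.Vec.Relation.Unary.Any using (Any)
open import Relation.Binary.Definitions using (DecidableEquality)
open import Relation.Binary.PropositionalEquality using (refl; cong)
open import Relation.Nullary.Decidable.Core using (no; map′)
open import Relation.Nullary.Negation.Core using (¬_)

data Literal (n : ℕ) : Set where
  pos neg : Fin n → Literal n

infix 4 _≟_

_≟_ : ∀ {n} → DecidableEquality (Literal n)
pos x ≟ pos y = map′ (cong pos) (λ { refl → refl }) (x Fin.≟ y)
pos x ≟ neg y = no λ ()
neg x ≟ pos y = no λ ()
neg x ≟ neg y = map′ (cong neg) (λ { refl → refl }) (x Fin.≟ y)

-- The conjunction of the listed literals.
Term : ℕ → Set
Term n = List (Literal n)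

-- The disjunction of m terms in the variables indexed by Fin n.
DNF : ℕ → ℕ → Set
DNF n m = Vec (Term n) m

-- Repeated occurrences of a literal in a term are counted once.  Bounding
-- this number is a weaker hypothesis than bounding the length of the list.
#literals : ∀ {n} → Term n → ℕ
#literals T = length (deduplicate _≟_ T)

HasWidth : ∀ {n m} → ℕ → DNF n m → Set
HasWidth w f = All (λ T → #literals T ≤ w) f

NonConstant : ∀ {n} → Term n → Set
NonConstant T = (∃[ l ] l ∈ T) × (∀ x → ¬ (pos x ∈ T × neg x ∈ T))

_OccursIn_ : ∀ {n m} → Literal n → DNF n m → Set
l OccursIn f = Any (l ∈_) f

Unate : ∀ {n m} → DNF n m → Set
Unate f = ∀ x → ¬ ((pos x) OccursIn f × (neg x) OccursIn f)

-- The subformula consisting of the terms of f whose index lies in S.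
_↾_ : ∀ {n m} → DNF n m → (S : Subset m) → DNF n ∣ S ∣
[]      ↾ []          = []
(T ∷ f) ↾ (true  ∷ S) = T ∷ (f ↾ S)
(T ∷ f) ↾ (false ∷ S) = f ↾ S

{-# OPTIONS --safe #-}

-- A uniformly random assignment a satisfies a term with k literals with
-- probability 2⁻ᵏ ≥ 2⁻ʷ, and the terms satisfied by a single assignment form a
-- unate formula.  The method of conditional expectations finds a good a: give
-- a term with k literals the weight 2ᵏ if a satisfies it and 0 otherwise.  This
-- weight is a product over the variables of factors whose average over the two
-- values of the variable is 1, so the variables can be fixed one at a time
-- without decreasing the total weight, which is m initially.  Each satisfied
-- term contributes at most 2ʷ to the final total.
module Submission where

open import Defs
open import Data.Bool.Base using (Bool; true; false; not; if_then_else_)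
open import Data.Fin.Base using (Fin; zero; suc)
import Data.Fin.Properties as Fin
open import Data.Fin.Subset using (Subset; ∣_∣)
open import Data.List.Base using (List; []; _∷_; deduplicate; length; map)
import Data.List.Membership.DecPropositional as DecMembership
open import Data.List.Membership.Propositional using (_∈_; _∉_)
open import Data.List.Membership.Propositional.Properties using (∈-deduplicate⁺)
open import Data.List.Relation.Unary.Any using (here; there)
open import Data.Nat.Base using (ℕ; zero; suc; _+_; _≤_; _*_; _^_; _<ᵇ_; NonZero; z≤n; s≤s)
open import Data.Nat.ListAction using (product)
open import Data.Nat.Properties hiding (_≟_)
open import Data.Product.Base using (_×_; Σ-syntax; ∃-syntax; _,_)
open import Data.Sum.Base using (_⊎_; inj₁; inj₂; [_,_]′)
open import Data.Vec.Base using ([]; _∷_; lookup)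
import Data.Vec.Functional as Vector
open import Data.Vec.Relation.Unary.All using (All)
open import Data.Vec.Relation.Unary.All.Properties using (lookup⁺)
open import Data.Vec.Relation.Unary.Any using (here; there)
open import Function.Base using (_∘_; _$_)
open import Relation.Binary.PropositionalEquality
open import Relation.Nullary.Decidable using (yes; no; does)
open import Relation.Nullary.Negation using (contradiction)

open import Algebra.Properties.Semiring.Sum +-*-semiring
  using (sum; ∑-distrib-+; sum-cong-≗; *-distribˡ-sum)
open import Algebra.Properties.CommutativeMonoid.Sum *-1-commutativeMonoid
  using () renaming (sum to ∏; ∑-distrib-+ to ∏-distrib-*; sum-replicate-zero to ∏-replicate-one)

m+n≡2*o⇒o≤m⊎o≤n : ∀ m n {o} → m + n ≡ 2 * o → o ≤ m ⊎ o ≤ n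
m+n≡2*o⇒o≤m⊎o≤n m n {o} eq with ≤-total m n
... | inj₁ m≤n = inj₂ $ *-cancelˡ-≤ 2 $ begin
  2 * o        ≡⟨ eq ⟨
  m + n        ≤⟨ +-monoˡ-≤ n m≤n ⟩
  n + n        ≡⟨ cong (n +_) (+-identityʳ n) ⟨
  2 * n        ∎
  where open ≤-Reasoning
... | inj₂ n≤m = inj₁ $ *-cancelˡ-≤ 2 $ begin
  2 * o        ≡⟨ eq ⟨
  m + n        ≤⟨ +-monoʳ-≤ m n≤m ⟩
  m + m        ≡⟨ cong (m +_) (+-identityʳ m) ⟨
  2 * m        ∎
  where open ≤-Reasoning

sum-one : ∀ m → sum {m} (λ _ → 1) ≡ m
sum-one zero    = refl
sum-one (suc m) = cong suc (sum-one m)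

∏-mono-≤ : ∀ {n} {g h : Fin n → ℕ} → (∀ x → g x ≤ h x) → ∏ g ≤ ∏ h
∏-mono-≤ {zero}  g≤h = ≤-refl
∏-mono-≤ {suc n} g≤h = *-mono-≤ (g≤h zero) (∏-mono-≤ (g≤h ∘ suc))

∏-nonZero⁻ : ∀ {n} (g : Fin n → ℕ) → NonZero (∏ g) → ∀ x → NonZero (g x)
∏-nonZero⁻ g ∏≢0 zero    = m*n≢0⇒m≢0 (g zero) {{∏≢0}}
∏-nonZero⁻ g ∏≢0 (suc x) = ∏-nonZero⁻ (g ∘ suc) (m*n≢0⇒n≢0 (g zero) {{∏≢0}}) x

-- A Boolean test is used so that `∣ support g ∣` and `f ↾ support g` both reduce once `g zero` is
-- matched.
support : ∀ {m} → (Fin m → ℕ) → Subset m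
support {zero}  g = []
support {suc m} g = (0 <ᵇ g zero) ∷ support (g ∘ suc)

-- Indices outside the support add nothing to the sum, and each one inside adds at most `k`. This
-- turns a large total weight into many satisfied terms.
sum≤bound*∣support∣ : ∀ {m} k (g : Fin m → ℕ) → (∀ j → g j ≤ k) → sum g ≤ k * ∣ support g ∣
sum≤bound*∣support∣ {zero}  k g g≤k = z≤n
sum≤bound*∣support∣ {suc m} k g g≤k with g zero | g≤k zero
... | zero  | _     = sum≤bound*∣support∣ k (g ∘ suc) (g≤k ∘ suc)
... | suc c | 1+c≤k = begin
  suc c + sum (g ∘ suc)              ≤⟨ +-mono-≤ 1+c≤k (sum≤bound*∣support∣ k (g ∘ suc) (g≤k ∘ suc)) ⟩
  k + k * ∣ support (g ∘ suc) ∣      ≡⟨ *-suc k _ ⟨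
  k * suc ∣ support (g ∘ suc) ∣      ∎
  where open ≤-Reasoning

-- Restriction renumbers the terms; this recovers the original index, at which `g` can be evaluated.
OccursIn-↾-support : ∀ {n m} (f : DNF n m) (g : Fin m → ℕ) {l} →
  l OccursIn (f ↾ support g) → ∃[ j ] (NonZero (g j) × l ∈ lookup f j)
OccursIn-↾-support (T ∷ f) g occ with g zero in eq
... | zero with j , gj≢0 , l∈ ← OccursIn-↾-support f (g ∘ suc) occ = suc j , gj≢0 , l∈
OccursIn-↾-support (T ∷ f) g (here l∈T)  | suc c = zero , subst NonZero (sym eq) _ , l∈T
OccursIn-↾-support (T ∷ f) g (there occ) | suc c
  with j , gj≢0 , l∈ ← OccursIn-↾-support f (g ∘ suc) occ = suc j , gj≢0 , l∈

-- The coefficients c carry the factors of the variables already fixed.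
conditional-expectations : ∀ n {m} (c : Fin m → ℕ) (g : Fin n → Bool → Fin m → ℕ) →
  (∀ x j → g x true j + g x false j ≡ 2) →
  Σ[ a ∈ (Fin n → Bool) ] sum c ≤ sum (λ j → c j * ∏ (λ x → g x (a x) j))
conditional-expectations zero    c g g-avg =
  (λ ()) , ≤-reflexive (sum-cong-≗ (sym ∘ *-identityʳ ∘ c))
conditional-expectations (suc n) c g g-avg =
  -- The totals for the two values of the first variable average to `sum c`, so at least one value
  -- loses nothing.
  [ fix true , fix false ]′ (m+n≡2*o⇒o≤m⊎o≤n (total true) (total false) total-avg)
  where
  total : Bool → ℕ
  total b = sum (λ j → c j * g zero b j)

  total-avg : total true + total false ≡ 2 * sum c
  total-avg = begin
    total true + total false
      ≡⟨ ∑-distrib-+ (λ j → c j * g zero true j) (λ j → c j * g zero false j) ⟨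
    sum (λ j → c j * g zero true j + c j * g zero false j)
      ≡⟨ sum-cong-≗ (λ j → trans (sym (*-distribˡ-+ (c j) _ _))
           (trans (cong (c j *_) (g-avg zero j)) (*-comm (c j) 2))) ⟩
    sum (λ j → 2 * c j)
      ≡⟨ *-distribˡ-sum 2 c ⟨
    2 * sum c ∎
    where open ≡-Reasoning

  fix : ∀ b → sum c ≤ total b →
    Σ[ a ∈ (Fin (suc n) → Bool) ] sum c ≤ sum (λ j → c j * ∏ (λ x → g x (a x) j))
  fix b c≤ with a , c′≤ ← conditional-expectations n (λ j → c j * g zero b j) (g ∘ suc) (g-avg ∘ suc) =
    b Vector.∷ a ,
    ≤-trans c≤ (≤-trans c′≤ (≤-reflexive (sum-cong-≗ (λ j → *-assoc (c j) (g zero b j) _))))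

var : ∀ {n} → Literal n → Fin n
var (pos x) = x
var (neg x) = x

literal : ∀ {n} → Bool → Fin n → Literal n
literal true  = pos
literal false = neg

var-literal : ∀ {n} b (x : Fin n) → var (literal b x) ≡ x
var-literal true  x = refl
var-literal false x = refl

module _ {n : ℕ} where
  open DecMembership (_≟_ {n}) using (_∈?_)

  -- The value `b` for `x` falsifies `literal (not b) x` (factor 0) and satisfies `literal b x`
  -- (factor 2). The falsified case is tested first, so it wins if `T` contains both.
  factor : Term n → Fin n → Bool → ℕ
  factor T x b =
    if does (literal (not b) x ∈? T) then 0 else
    if does (literal b x ∈? T) then 2 else 1

  -- The sum is 0 + 2 in some order if `x` occurs with one sign, and 1 + 1 if it does not occur.
  -- With both signs it would be 0 + 0, which consistency excludes.
  factor-avg : ∀ {T} → NonConstant T → ∀ x → factor T x true + factor T x false ≡ 2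
  factor-avg {T} (_ , consistent) x with pos x ∈? T | neg x ∈? T
  ... | yes p | yes q = contradiction (p , q) (consistent x)
  ... | yes p | no  _ = refl
  ... | no  _ | yes q = refl
  ... | no  _ | no  _ = refl

  factor≢0⇒¬falsified : ∀ T x b → NonZero (factor T x b) → literal (not b) x ∉ T
  factor≢0⇒¬falsified T x b nz l∈T with literal (not b) x ∈? T
  factor≢0⇒¬falsified T x b () l∈T | yes _
  ... | no l∉T = contradiction l∈T l∉T

  weight : (Fin n → Bool) → Term n → ℕ
  weight a T = ∏ (λ x → factor T x (a x))

  -- Used to compare a product over variables with one over literals: each literal contributes a 2
  -- at its own variable and a 1 elsewhere.
  doubling : Fin n → Literal n → ℕ
  doubling x l = if does (x Fin.≟ var l) then 2 else 1

  1≤doubling : ∀ x l → 1 ≤ doubling x l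
  1≤doubling x l with does (x Fin.≟ var l)
  ... | true  = s≤s z≤n
  ... | false = s≤s z≤n

  1≤product-doubling : ∀ x (D : List (Literal n)) → 1 ≤ product (map (doubling x) D)
  1≤product-doubling x []      = ≤-refl
  1≤product-doubling x (l ∷ D) = *-mono-≤ (1≤doubling x l) (1≤product-doubling x D)

  2≤product-doubling : ∀ x {l} {D : List (Literal n)} → l ∈ D → var l ≡ x →
    2 ≤ product (map (doubling x) D)
  2≤product-doubling x {l} {_ ∷ D} (here refl) refl with x Fin.≟ x
  ... | yes _  = *-monoʳ-≤ 2 (1≤product-doubling x D)
  ... | no x≢x = contradiction refl x≢x
  2≤product-doubling x {l} {l′ ∷ D} (there l∈D) eq =
    *-mono-≤ (1≤doubling x l′) (2≤product-doubling x l∈D eq)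

  -- A factor 2 is witnessed by a literal of `T` on `x`, which doubles the right side. `D` will be
  -- the deduplicated `T`, so that distinct literals are counted.
  factor≤product-doubling : ∀ T x b {D} → (∀ {l} → l ∈ T → l ∈ D) →
    factor T x b ≤ product (map (doubling x) D)
  factor≤product-doubling T x b {D} T⊆D with literal (not b) x ∈? T | literal b x ∈? T
  ... | yes _ | _       = z≤n
  ... | no  _ | yes l∈T = 2≤product-doubling x (T⊆D l∈T) (var-literal b x)
  ... | no  _ | no  _   = 1≤product-doubling x D

∏-indicator : ∀ {n} (y : Fin n) → ∏ (λ x → if does (x Fin.≟ y) then 2 else 1) ≡ 2
∏-indicator {suc n} zero    = cong (2 *_) (∏-replicate-one n)
∏-indicator {suc n} (suc y) = trans (*-identityˡ _) (∏-indicator y)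

-- Exchanging the two products leaves, for each entry of `D`, a product over variables with a single
-- 2.
∏-product-doubling : ∀ {n} (D : List (Literal n)) →
  ∏ (λ x → product (map (doubling x) D)) ≡ 2 ^ length D
∏-product-doubling {n} []      = ∏-replicate-one n
∏-product-doubling {n} (l ∷ D) = trans
  (∏-distrib-* (λ x → doubling x l) (λ x → product (map (doubling x) D)))
  (cong₂ _*_ (∏-indicator (var l)) (∏-product-doubling D))

weight≤2^#literals : ∀ {n} (a : Fin n → Bool) T → weight a T ≤ 2 ^ #literals T
weight≤2^#literals a T = ≤-trans
  (∏-mono-≤ (λ x → factor≤product-doubling T x (a x) (∈-deduplicate⁺ _≟_)))
  (≤-reflexive (∏-product-doubling (deduplicate _≟_ T)))

-- Every selected term has nonzero weight, so `a` falsifies none of its literals; but `a x`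
-- falsifies one of `pos x` and `neg x`.
unate-↾-support-weight : ∀ {n m} (a : Fin n → Bool) (f : DNF n m) →
  Unate (f ↾ support (weight a ∘ lookup f))
unate-↾-support-weight a f x (pos-occ , neg-occ)
  with j , wj≢0 , pos∈ ← OccursIn-↾-support f (weight a ∘ lookup f) pos-occ
     | k , wk≢0 , neg∈ ← OccursIn-↾-support f (weight a ∘ lookup f) neg-occ
  with a x | ∏-nonZero⁻ (λ y → factor (lookup f j) y (a y)) wj≢0 x
           | ∏-nonZero⁻ (λ y → factor (lookup f k) y (a y)) wk≢0 x
... | true  | _  | nz = factor≢0⇒¬falsified (lookup f k) x true nz neg∈
... | false | nz | _  = factor≢0⇒¬falsified (lookup f j) x false nz pos∈

lemma2p7 : ∀ (n m w : ℕ) (f : DNF n m) → HasWidth w f → All NonConstant f →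
    Σ[ S ∈ Subset m ] (m ≤ 2 ^ w * ∣ S ∣ × Unate (f ↾ S))
lemma2p7 n m w f width nonconst
  -- No variable is fixed yet, so all coefficients are 1 and the initial total is `m`.
  with a , m≤ ← conditional-expectations n {m} (λ _ → 1) (λ x b j → factor (lookup f j) x b)
                  (λ x j → factor-avg (lookup⁺ nonconst j) x) =
  support (weight a ∘ lookup f) , large , unate-↾-support-weight a f
  where
  open ≤-Reasoning

  large : m ≤ 2 ^ w * ∣ support (weight a ∘ lookup f) ∣
  large = begin
    m                                           ≡⟨ sum-one m ⟨
    sum {m} (λ _ → 1)                           ≤⟨ m≤ ⟩
    sum (λ j → 1 * weight a (lookup f j))       ≡⟨ sum-cong-≗ (λ j → *-identityˡ (weight a (lookup f j))) ⟩
    sum (weight a ∘ lookup f)                   ≤⟨ sum≤bound*∣support∣ (2 ^ w) (weight a ∘ lookup f) weight≤2^w ⟩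
    2 ^ w * ∣ support (weight a ∘ lookup f) ∣   ∎
    where
    weight≤2^w : ∀ j → weight a (lookup f j) ≤ 2 ^ w
    weight≤2^w j = ≤-trans (weight≤2^#literals a (lookup f j)) (^-monoʳ-≤ 2 (lookup⁺ width j))
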